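{- $[\mathcal{R}\mathbf{Txt}\mathbf{Td}\mathbf{CInd}\mathbf{Ex}_C]_{\mathbf{REC}} \subsetneq [\mathbf{Txt}\mathbf{Td}\mathbf{CInd}\mathbf{Ex}_C]_{\mathbf{REC}}$.
   Context: Fix an acceptable numbering $(\varphi_e)_{e\in\mathbb{N}}$ of all partial computable functions. A number $e$ is a $C$-index if $\varphi_e$ is total with values in $\{0,1\}$; then $C_e=\{x:\varphi_e(x)=1\}$. $\mathbf{REC}$ is the collection of recursive subsets of $\mathbb{N}$; $\mathcal{P}$ and $\mathcal{R}$ are the partial computable and total computable functions. Fix a pause symbol $\#$. A text is a total function $T:\mathbb{N}\to\mathbb{N}\cup\{\#\}$, $\mathrm{content}(T)=\mathrm{range}(T)\setminus\{\#\}$, $T$ is a text for $L$ if $\mathrm{content}(T)=L$. A learner is some $h\in\mathcal{P}$, which may output a special symbol "?" meaning "no new hypothesis". Transductive hypothesis sequence: $\mathbf{Td}(h,T)(0)=?$, and for $i>0$, $\mathbf{Td}(h,T)(i)=\mathbf{Td}(h,T)(i-1)$ if $h(T(i-1))=?$, else $h(T(i-1))$. Restrictions on a hypothesis sequence $p$ and text $T$: $\mathbf{Ex}_C$: there is $n_0$ with $p(n)=p(n_0)$ for all $n\ge n_0$ and $p(n_0)$ a $C$-index with $C_{p(n_0)}=\mathrm{content}(T)$; $\mathbf{CInd}$: for all $i$, $p(i)$ is a $C$-index. Juxtaposition means conjunction. For $\mathcal{C}\in\{\mathcal{P},\mathcal{R}\}$ (omitted means $\mathcal{P}$), $h\in\mathcal{C}$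 $\mathcal{C}\mathbf{Txt}\beta\delta$-learns $L$ iff $\delta(\beta(h,T),T)$ holds for every text $T$ for $L$; $[\mathcal{C}\mathbf{Txt}\beta\delta]_{\mathbf{REC}}$ is the set of all classes $\mathcal{L}\subseteq\mathbf{REC}$ for which some $h\in\mathcal{C}$ learns every $L\in\mathcal{L}$. -}

module Defs where

open import Level using (Level; 0ℓ) renaming (suc to lsuc)
open import Data.Nat using (ℕ; zero; suc; _≤_; _%_; _/_)
open import Data.Product using (Σ; ∃; ∃-syntax; _×_; _,_; proj₁; proj₂)
open import Data.Sum using (_⊎_)
open import Data.Maybe using (Maybe; just; nothing; _>>=_)
open import Data.List using (List; []; _∷_)
open import Relation.Binary.PropositionalEquality using (_≡_)
open import Relation.Nullary using (¬_)
open import Function.Bundles using (_⇔_)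

-- A concrete model of computation: μ-recursive function codes.

data Code : Set where
  Z : Code
  S : Code
  P : ℕ → Code                 -- i-th projection (0 if missing)
  C : Code → List Code → Code
  R : Code → Code → Code
  M : Code → Code

head0 : List ℕ → ℕ
head0 []      = 0
head0 (x ∷ _) = x

tail0 : List ℕ → List ℕ
tail0 []       = []
tail0 (_ ∷ xs) = xs

nth0 : ℕ → List ℕ → ℕ
nth0 _       []       = 0
nth0 zero    (x ∷ _)  = x
nth0 (suc i) (_ ∷ xs) = nth0 i xs

-- Fuel-bounded evaluation; `just y` is returned only for the true value.
mutual
  eval : ℕ → Code → List ℕ → Maybe ℕ
  eval zero    _        _  = nothing
  eval (suc k) Z        _  = just 0
  eval (suc k) S        xs = just (suc (head0 xs))
  eval (suc k) (P i)    xs = just (nth0 i xs)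
  eval (suc k) (C f gs) xs = evalL k gs xs >>= eval k f
  eval (suc k) (R f g)  xs = evalR k f g (head0 xs) (tail0 xs)
  eval (suc k) (M f)    xs = evalM k f xs 0

  evalL : ℕ → List Code → List ℕ → Maybe (List ℕ)
  evalL zero    _        _  = nothing
  evalL (suc k) []       xs = just []
  evalL (suc k) (g ∷ gs) xs =
    eval k g xs >>= λ y → evalL k gs xs >>= λ ys → just (y ∷ ys)

  evalR : ℕ → Code → Code → ℕ → List ℕ → Maybe ℕ
  evalR zero    _ _ _       _  = nothing
  evalR (suc k) f g zero    xs = eval k f xs
  evalR (suc k) f g (suc y) xs = evalR k f g y xs >>= λ r → eval k g (y ∷ r ∷ xs)

  evalM : ℕ → Code → List ℕ → ℕ → Maybe ℕ
  evalM zero    _ _  _ = nothing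
  evalM (suc k) f xs y = eval k f (y ∷ xs) >>= λ
    { zero    → just y
    ; (suc _) → evalM k f xs (suc y) }

-- Gödel numbering of codes (Cantor pairing, computed by iteration).

cstep : ℕ × ℕ → ℕ × ℕ
cstep (a , zero)  = (0 , suc a)
cstep (a , suc b) = (suc a , b)

unpair : ℕ → ℕ × ℕ
unpair zero    = (0 , 0)
unpair (suc n) = cstep (unpair n)

mutual
  decode' : ℕ → ℕ → Code
  decode' zero    _ = Z
  decode' (suc k) n = decTag k (n % 6) (n / 6)

  decTag : ℕ → ℕ → ℕ → Code
  decTag k 0 r = Z
  decTag k 1 r = S
  decTag k 2 r = P r
  decTag k 3 r = C (decode' k (proj₁ (unpair r))) (decodeL k (proj₂ (unpair r)))
  decTag k 4 r = R (decode' k (proj₁ (unpair r))) (decode' k (proj₂ (unpair r)))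
  decTag k _ r = M (decode' k r)

  decodeL : ℕ → ℕ → List Code
  decodeL zero    _       = []
  decodeL (suc k) zero    = []
  decodeL (suc k) (suc m) = decode' k (proj₁ (unpair m)) ∷ decodeL k (proj₂ (unpair m))

decode : ℕ → Code
decode n = decode' n n

_·_↓_ : ℕ → ℕ → ℕ → Set
e · x ↓ y = ∃[ k ] eval k (decode e) (x ∷ []) ≡ just y

Total : ℕ → Set
Total e = ∀ x → ∃[ y ] e · x ↓ y

CIndex : ℕ → Set
CIndex e = Total e × (∀ x y → e · x ↓ y → y ≤ 1)

_∈C_ : ℕ → ℕ → Set
x ∈C e = e · x ↓ 1

SetN : Set₁
SetN = ℕ → Set

_≐_ : SetN → SetN → Set
A ≐ B = ∀ x → (A x ⇔ B x)

IsREC : SetN → Set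
IsREC L = ∃[ e ] (CIndex e × (L ≐ (λ x → x ∈C e)))

-- texts: nothing = pause symbol #
Text : Set
Text = ℕ → Maybe ℕ

content : Text → SetN
content T x = ∃[ i ] T i ≡ just x

codeIn : Maybe ℕ → ℕ
codeIn nothing  = 0
codeIn (just n) = suc n

-- Hypothesis sequences: nothing = "?".
HypSeq : Set
HypSeq = ℕ → Maybe ℕ

-- p is the transductive hypothesis sequence Td(h,T) (and it is total).
-- Learner outputs are coded: 0 ↦ ?, q+1 ↦ hypothesis q.
IsTd : ℕ → Text → HypSeq → Set
IsTd h T p =
  (p 0 ≡ nothing) ×
  (∀ i → ((h · codeIn (T i) ↓ 0) × (p (suc i) ≡ p i))
       ⊎ (∃[ q ] ((h · codeIn (T i) ↓ suc q) × (p (suc i) ≡ just q))))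

CInd : HypSeq → Set
CInd p = ∀ i → (p i ≡ nothing) ⊎ (∃[ e ] ((p i ≡ just e) × CIndex e))

ExC : HypSeq → Text → Set
ExC p T = ∃[ n₀ ] ((∀ n → n₀ ≤ n → p n ≡ p n₀) ×
                   ∃[ e ] ((p n₀ ≡ just e) × CIndex e × ((λ x → x ∈C e) ≐ content T)))

Learns : ℕ → SetN → Set
Learns h L = ∀ (T : Text) → content T ≐ L →
  ∃[ p ] (IsTd h T p × CInd p × ExC p T)

InP : (SetN → Set) → Set₁
InP 𝓛 = ∃[ h ] (∀ L → 𝓛 L → IsREC L × Learns h L)

InR : (SetN → Set) → Set₁
InR 𝓛 = ∃[ h ] (Total h × (∀ L → 𝓛 L → IsREC L × Learns h L))

{-# OPTIONS --safe #-}
-- A datum is a pair (t, x), and ψ(x) runs the program x on the datum (0, x). The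
-- separating class consists of the sets {(0, x), (t, x)} with ψ(x) defined, where
-- t = 0 if ψ(x) = 0 and t > 0 otherwise. A partial learner computes ψ(x) first: it
-- may then answer (0, x) with a hypothesis if ψ(x) = 0 and with "?" otherwise, while
-- (t, x) with t > 0 already determines the set. For a total learner h, let x be a
-- program of h, so that ψ(x) = h(0, x). If h answers "?" on (0, x), then {(0, x)} is in
-- the class but the text (0, x), (0, x), … never gets a hypothesis. Otherwise the
-- sets {(0, x), (t, x)} with t > 0 are all in the class, and the text
-- (t, x), (0, x), (0, x), … forces the one hypothesis h(0, x) to be correct for each
-- of them.
module Submission where

open import Defs
open import Data.Product using (_×_; ∃-syntax; _,_; proj₁; proj₂)
open import Relation.Nullary using (¬_)
open import Data.Nat using (ℕ; zero; suc; pred; _+_; _*_; _∸_; _≤_; _<_; z≤n; s≤s; _⊔_)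
open import Data.Nat.Properties
open import Data.Nat.DivMod using ([m+kn]%n≡m%n; m<n⇒m%n≡m; +-distrib-/-∣ʳ; m<n⇒m/n≡0; m*n/n≡m)
open import Data.Nat.Divisibility using (n∣m*n)
open import Data.Sum using (_⊎_; inj₁; inj₂)
open import Data.Maybe using (Maybe; just; nothing; _>>=_)
open import Data.Maybe.Properties using (just-injective)
open import Data.List using (List; []; _∷_; map)
open import Data.Empty using (⊥-elim)
open import Function using (case_of_)
open import Function.Bundles using (mk⇔; Equivalence)
open import Function.Construct.Identity using (⇔-id)
open import Function.Construct.Symmetry using (⇔-sym)
open import Function.Construct.Composition using (_⇔-∘_)
open import Relation.Binary.PropositionalEquality

-- Evaluation as a single-valued relation

infix 4 _⟨_⟩⇓_ _⟨_⟩⇓*_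

_⟨_⟩⇓_ : Code → List ℕ → ℕ → Set
c ⟨ xs ⟩⇓ y = ∃[ k ] eval k c xs ≡ just y

_⟨_⟩⇓*_ : List Code → List ℕ → List ℕ → Set
gs ⟨ xs ⟩⇓* ys = ∃[ k ] evalL k gs xs ≡ just ys

>>=-inversion : ∀ {A B : Set} (m : Maybe A) (f : A → Maybe B) {b} →
                (m >>= f) ≡ just b → ∃[ a ] (m ≡ just a × f a ≡ just b)
>>=-inversion (just a) f eq = a , refl , eq

mutual
  -- Fuel bounds the depth of the recursion but never influences a value. Computations with
  -- different fuel can therefore be raised to the maximum and combined.
  eval-mono : ∀ {k l} c xs {y} → k ≤ l → eval k c xs ≡ just y → eval l c xs ≡ just y
  eval-mono Z        xs (s≤s _)  eq = eq
  eval-mono S        xs (s≤s _)  eq = eq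
  eval-mono (P i)    xs (s≤s _)  eq = eq
  eval-mono {suc k} (C f gs) xs (s≤s le) eq
    with ys , eq₁ , eq₂ ← >>=-inversion (evalL k gs xs) _ eq
    rewrite evalL-mono gs xs le eq₁ = eval-mono f ys le eq₂
  eval-mono (R f g)  xs (s≤s le) eq = evalR-mono f g (head0 xs) (tail0 xs) le eq
  eval-mono (M f)    xs (s≤s le) eq = evalM-mono f xs 0 le eq

  evalL-mono : ∀ {k l} gs xs {ys} → k ≤ l → evalL k gs xs ≡ just ys → evalL l gs xs ≡ just ys
  evalL-mono []       xs (s≤s _)  eq = eq
  evalL-mono {suc k} (g ∷ gs) xs (s≤s le) eq
    with y , eq₁ , eq₂ ← >>=-inversion (eval k g xs) _ eq
    with ys , eq₃ , eq₄ ← >>=-inversion (evalL k gs xs) _ eq₂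
    rewrite eval-mono g xs le eq₁ | evalL-mono gs xs le eq₃ = eq₄

  evalR-mono : ∀ {k l} f g n xs {y} → k ≤ l → evalR k f g n xs ≡ just y → evalR l f g n xs ≡ just y
  evalR-mono f g zero    xs (s≤s le) eq = eval-mono f xs le eq
  evalR-mono {suc k} f g (suc n) xs (s≤s le) eq
    with r , eq₁ , eq₂ ← >>=-inversion (evalR k f g n xs) _ eq
    rewrite evalR-mono f g n xs le eq₁ = eval-mono g (n ∷ r ∷ xs) le eq₂

  evalM-mono : ∀ {k l} f xs n {y} → k ≤ l → evalM k f xs n ≡ just y → evalM l f xs n ≡ just y
  evalM-mono {suc k} f xs n (s≤s le) eq with >>=-inversion (eval k f (n ∷ xs)) _ eq
  ... | zero  , eq₁ , eq₂ rewrite eval-mono f (n ∷ xs) le eq₁ = eq₂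
  ... | suc _ , eq₁ , eq₂ rewrite eval-mono f (n ∷ xs) le eq₁ = evalM-mono f xs (suc n) le eq₂

⇓-functional : ∀ {c xs y z} → c ⟨ xs ⟩⇓ y → c ⟨ xs ⟩⇓ z → y ≡ z
⇓-functional {c} {xs} (k , p) (l , q) =
  just-injective (trans (sym (eval-mono c xs (m≤m⊔n k l) p)) (eval-mono c xs (m≤n⊔m k l) q))

⇓-C : ∀ {f gs xs ys y} → gs ⟨ xs ⟩⇓* ys → f ⟨ ys ⟩⇓ y → C f gs ⟨ xs ⟩⇓ y
⇓-C {f} {gs} {xs} {ys} {y} (k , p) (l , q) = suc (k ⊔ l) , lemma
  where
  lemma : (evalL (k ⊔ l) gs xs >>= eval (k ⊔ l) f) ≡ just y
  lemma rewrite evalL-mono gs xs (m≤m⊔n k l) p = eval-mono f ys (m≤n⊔m k l) q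

⇓*-[] : ∀ {xs} → [] ⟨ xs ⟩⇓* []
⇓*-[] = 1 , refl

⇓*-∷ : ∀ {g gs xs y ys} → g ⟨ xs ⟩⇓ y → gs ⟨ xs ⟩⇓* ys → (g ∷ gs) ⟨ xs ⟩⇓* (y ∷ ys)
⇓*-∷ {g} {gs} {xs} {y} {ys} (k , p) (l , q) = suc (k ⊔ l) , lemma
  where
  lemma : evalL (suc (k ⊔ l)) (g ∷ gs) xs ≡ just (y ∷ ys)
  lemma rewrite eval-mono g xs (m≤m⊔n k l) p | evalL-mono gs xs (m≤n⊔m k l) q = refl

-- Total recursive functions

-- Function, code and correctness proof travel together, so that an arithmetic expression in the
-- combinators below yields a verified code.
record Fn : Set where
  field
    fun      : List ℕ → ℕ
    code     : Code
    computes : ∀ xs → code ⟨ xs ⟩⇓ fun xs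
open Fn

zeroᶠ : Fn
zeroᶠ = record { fun = λ _ → 0 ; code = Z ; computes = λ _ → 1 , refl }

var : ℕ → Fn
var i = record { fun = nth0 i ; code = P i ; computes = λ _ → 1 , refl }

all-compute : ∀ gs xs → map code gs ⟨ xs ⟩⇓* map (λ g → fun g xs) gs
all-compute []       xs = ⇓*-[]
all-compute (g ∷ gs) xs = ⇓*-∷ (computes g xs) (all-compute gs xs)

compose : Fn → List Fn → Fn
compose f gs = record
  { fun      = λ xs → fun f (map (λ g → fun g xs) gs)
  ; code     = C (code f) (map code gs)
  ; computes = λ xs → ⇓-C (all-compute gs xs) (computes f _)
  }

sucᶠ : Fn → Fn
sucᶠ f = compose (record { fun = λ xs → suc (head0 xs) ; code = S ; computes = λ _ → 1 , refl }) (f ∷ [])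

primRec : (List ℕ → ℕ) → (List ℕ → ℕ) → ℕ → List ℕ → ℕ
primRec f g zero    xs = f xs
primRec f g (suc n) xs = g (n ∷ primRec f g n xs ∷ xs)

recᶠ : Fn → Fn → Fn
recᶠ f g = record
  { fun      = λ xs → primRec (fun f) (fun g) (head0 xs) (tail0 xs)
  ; code     = R (code f) (code g)
  ; computes = λ xs → let k , p = iterates (head0 xs) (tail0 xs) in suc k , p
  }
  where
  iterates : ∀ n xs → ∃[ k ] evalR k (code f) (code g) n xs ≡ just (primRec (fun f) (fun g) n xs)
  iterates zero    xs = let k , p = computes f xs in suc k , p
  iterates (suc n) xs
    with k , p ← iterates n xs
    with l , q ← computes g (n ∷ primRec (fun f) (fun g) n xs ∷ xs) = suc (k ⊔ l) , lemma
    where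
    lemma : evalR (suc (k ⊔ l)) (code f) (code g) (suc n) xs
            ≡ just (primRec (fun f) (fun g) (suc n) xs)
    lemma rewrite evalR-mono (code f) (code g) n xs (m≤m⊔n k l) p =
      eval-mono (code g) _ (m≤n⊔m k l) q

-- Replacing the function of `F` by a given `f` makes `fun` of a compound term unfold to ordinary
-- arithmetic instead of nested `primRec`.
lift₁ : (F : Fn) (f : ℕ → ℕ) → (∀ a → fun F (a ∷ []) ≡ f a) → Fn → Fn
lift₁ F f eq g = record
  { fun      = λ xs → f (fun g xs)
  ; code     = code (compose F (g ∷ []))
  ; computes = λ xs → subst (code (compose F (g ∷ [])) ⟨ xs ⟩⇓_) (eq _) (computes (compose F (g ∷ [])) xs)
  }

lift₂ : (F : Fn) (f : ℕ → ℕ → ℕ) → (∀ a b → fun F (a ∷ b ∷ []) ≡ f a b) → Fn → Fn → Fn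
lift₂ F f eq g h = record
  { fun      = λ xs → f (fun g xs) (fun h xs)
  ; code     = code (compose F (g ∷ h ∷ []))
  ; computes = λ xs → subst (code (compose F (g ∷ h ∷ [])) ⟨ xs ⟩⇓_) (eq _ _)
                            (computes (compose F (g ∷ h ∷ [])) xs)
  }

constant : ℕ → Code
constant zero    = Z
constant (suc n) = C S (constant n ∷ [])

constant-⇓ : ∀ n xs → constant n ⟨ xs ⟩⇓ n
constant-⇓ zero    xs = 1 , refl
constant-⇓ (suc n) xs = ⇓-C (⇓*-∷ (constant-⇓ n xs) ⇓*-[]) (1 , refl)

lit : ℕ → Fn
lit n = record { fun = λ _ → n ; code = constant n ; computes = constant-⇓ n }

ifz : ℕ → ℕ → ℕ → ℕ
ifz zero    a b = a
ifz (suc _) a b = b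

ifzᶠ : Fn → Fn → Fn → Fn
ifzᶠ c f g = record
  { fun      = λ xs → ifz (fun c xs) (fun f xs) (fun g xs)
  ; code     = code F
  ; computes = λ xs → subst (code F ⟨ xs ⟩⇓_) (spec (fun c xs)) (computes F xs)
  }
  where
  F : Fn
  -- The recursion ignores its recursive value: the base case returns the first parameter, and each
  -- step returns the second one, which stands behind the counter, the recursive value and the first
  -- parameter.
  F = compose (recᶠ (var 0) (var 3)) (c ∷ f ∷ g ∷ [])

  spec : ∀ n {a b} → primRec (nth0 0) (nth0 3) n (a ∷ b ∷ []) ≡ ifz n a b
  spec zero    = refl
  spec (suc n) = refl

predᶠ : Fn → Fn
predᶠ = lift₁ (recᶠ zeroᶠ (var 0)) pred λ { zero → refl ; (suc _) → refl }

infixl 6 _+ᶠ_ _∸ᶠ_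

_+ᶠ_ : Fn → Fn → Fn
_+ᶠ_ = lift₂ F _+_ spec
  where
  F : Fn
  F = recᶠ (var 0) (sucᶠ (var 1))

  spec : ∀ a b → fun F (a ∷ b ∷ []) ≡ a + b
  spec zero    b = refl
  spec (suc a) b = cong suc (spec a b)

_∸ᶠ_ : Fn → Fn → Fn
f ∸ᶠ g = lift₂ F (λ n m → m ∸ n) spec g f
  where
  F : Fn
  F = recᶠ (var 0) (predᶠ (var 1))

  spec : ∀ n m → fun F (n ∷ m ∷ []) ≡ m ∸ n
  spec zero    m = refl
  spec (suc n) m = trans (cong pred (spec n m)) (pred[m∸n]≡m∸[1+n] m n)

-- Cantor pairing

-- The triangular numbers: the position at which the enumeration `unpair` starts a new antidiagonal.
triangle : ℕ → ℕ
triangle zero    = 0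
triangle (suc s) = suc (s + triangle s)

triangleᶠ : Fn → Fn
triangleᶠ = lift₁ F triangle spec
  where
  F : Fn
  F = recᶠ zeroᶠ (sucᶠ (var 0 +ᶠ var 1))

  spec : ∀ s → fun F (s ∷ []) ≡ triangle s
  spec zero    = refl
  spec (suc s) = cong (λ t → suc (s + t)) (spec s)

fst snd : ℕ → ℕ
fst n = proj₁ (unpair n)
snd n = proj₂ (unpair n)

-- Within an antidiagonal each `cstep` moves one unit from the second component to the first, so (a
-- , b) comes a steps after (0 , s).
unpair-diagonal : ∀ {n s} a b → unpair n ≡ (0 , s) → a + b ≡ s → unpair (a + n) ≡ (a , b)
unpair-diagonal zero    b eq refl = eq
unpair-diagonal (suc a) b eq refl =
  cong cstep (unpair-diagonal a (suc b) eq (+-suc a b))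

unpair-triangle : ∀ s → unpair (triangle s) ≡ (0 , s)
unpair-triangle zero    = refl
unpair-triangle (suc s) = cong cstep (unpair-diagonal s 0 (unpair-triangle s) (+-identityʳ s))

-- Opaque, so that the indices built from it are never evaluated.
opaque
  pair : ℕ → ℕ → ℕ
  pair a b = a + triangle (a + b)

  pair-def : ∀ a b → a + triangle (a + b) ≡ pair a b
  pair-def a b = refl

  unpair-pair : ∀ a b → unpair (pair a b) ≡ (a , b)
  unpair-pair a b = unpair-diagonal a b (unpair-triangle (a + b)) refl

pairᶠ : Fn → Fn → Fn
pairᶠ = lift₂ (var 0 +ᶠ triangleᶠ (var 0 +ᶠ var 1)) pair pair-def

fst-pair : ∀ a b → fst (pair a b) ≡ a
fst-pair a b = cong proj₁ (unpair-pair a b)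

snd-pair : ∀ a b → snd (pair a b) ≡ b
snd-pair a b = cong proj₂ (unpair-pair a b)

triangle-unpair : ∀ n → triangle (fst n + snd n) + fst n ≡ n
triangle-unpair zero = refl
triangle-unpair (suc n) with unpair n | triangle-unpair n
... | a , zero  | eq rewrite +-identityʳ (a + triangle a) | +-identityʳ a =
  cong suc (trans (+-comm a (triangle a)) eq)
... | a , suc b | eq = begin
  triangle (suc a + b) + suc a    ≡⟨ +-suc _ a ⟩
  suc (triangle (suc a + b) + a)  ≡⟨ cong (λ s → suc (triangle s + a)) (sym (+-suc a b)) ⟩
  suc (triangle (a + suc b) + a)  ≡⟨ cong suc eq ⟩
  suc n                           ∎
  where open ≡-Reasoning

m≤triangle[m] : ∀ m → m ≤ triangle m
m≤triangle[m] zero    = z≤n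
m≤triangle[m] (suc m) = s≤s (m≤m+n m _)

n∸triangle≡fst : ∀ n → n ∸ triangle (fst n + snd n) ≡ fst n
n∸triangle≡fst n = trans (cong (_∸ t) (sym (triangle-unpair n))) (m+n∸m≡n t (fst n))
  where t = triangle (fst n + snd n)

-- The sum d of the components is primitive recursive by itself: it grows by one exactly when
-- `snd n` is 0, and `snd n` is recovered as d ∸ (n ∸ triangle d).
diagonalᶠ : Fn → Fn
diagonalᶠ = lift₁ F (λ n → fst n + snd n) spec
  where
  F : Fn
  F = recᶠ zeroᶠ (ifzᶠ (var 1 ∸ᶠ (var 0 ∸ᶠ triangleᶠ (var 1))) (sucᶠ (var 1)) (var 1))

  next : ∀ p → ifz (proj₂ p) (suc (proj₁ p + proj₂ p)) (proj₁ p + proj₂ p)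
               ≡ proj₁ (cstep p) + proj₂ (cstep p)
  next (a , zero)  = cong suc (+-identityʳ a)
  next (a , suc b) = +-suc a b

  spec : ∀ n → fun F (n ∷ []) ≡ fst n + snd n
  spec zero = refl
  spec (suc n) rewrite spec n | n∸triangle≡fst n | m+n∸m≡n (fst n) (snd n) = next (unpair n)

fstᶠ sndᶠ : Fn → Fn
fstᶠ = lift₁ (var 0 ∸ᶠ triangleᶠ (diagonalᶠ (var 0))) fst n∸triangle≡fst
sndᶠ = lift₁ (diagonalᶠ (var 0) ∸ᶠ fstᶠ (var 0)) snd λ n → m+n∸m≡n (fst n) (snd n)

-- Surjectivity of the numbering

opaque
  node : ℕ → ℕ → ℕ
  node t r = t + r * 6

  node≰0 : ∀ {t r} → ¬ (node (suc t) r ≤ 0)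
  node≰0 ()

  node-suc : ∀ t r → node t (suc r) ≡ 6 + node t r
  node-suc t r = trans (sym (+-assoc t 6 (r * 6)))
                       (trans (cong (_+ r * 6) (+-comm t 6)) (+-assoc 6 t (r * 6)))

  node-zero : ∀ t → node t 0 ≡ t
  node-zero t = +-identityʳ t

  decode'-node : ∀ {t} → t < 6 → ∀ k r → decode' (suc k) (node t r) ≡ decTag k t r
  decode'-node {t} t<6 k r = cong₂ (decTag k)
    (trans ([m+kn]%n≡m%n t r 6) (m<n⇒m%n≡m t<6))
    (trans (+-distrib-/-∣ʳ t (n∣m*n r)) (cong₂ _+_ (m<n⇒m/n≡0 t<6) (m*n/n≡m r 6)))

  -- With a positive tag the operand is strictly below the node, so one unit of fuel less still
  -- suffices for it.
  arg≤fuel : ∀ {t r k} → node (suc t) r ≤ suc k → r ≤ k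
  arg≤fuel {t} {r} (s≤s le) = ≤-trans (≤-trans (m≤m*n r 6) (m≤n+m (r * 6) t)) le

opaque
  unfolding pair

  fst≤pair : ∀ a b → a ≤ pair a b
  fst≤pair a b = m≤m+n a _

  snd≤pair : ∀ a b → b ≤ pair a b
  snd≤pair a b = ≤-trans (≤-trans (m≤n+m b a) (m≤triangle[m] (a + b))) (m≤n+m _ a)

mutual
  index : Code → ℕ
  index Z        = node 0 0
  index S        = node 1 0
  index (P i)    = node 2 i
  index (C f gs) = node 3 (pair (index f) (indices gs))
  index (R f g)  = node 4 (pair (index f) (index g))
  index (M f)    = node 5 (index f)

  indices : List Code → ℕ
  indices []       = 0
  indices (g ∷ gs) = suc (pair (index g) (indices gs))

mutual
  -- Induction on the fuel, which is kept at least as large as the number to be decoded; `decode`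
  -- starts with the two equal. At fuel 0 only `Z` has an index small enough.
  decode'-index : ∀ k c → index c ≤ k → decode' k (index c) ≡ c
  decode'-index zero    Z        le = refl
  decode'-index zero    S        le = ⊥-elim (node≰0 le)
  decode'-index zero    (P i)    le = ⊥-elim (node≰0 le)
  decode'-index zero    (C f gs) le = ⊥-elim (node≰0 le)
  decode'-index zero    (R f g)  le = ⊥-elim (node≰0 le)
  decode'-index zero    (M f)    le = ⊥-elim (node≰0 le)
  decode'-index (suc k) Z        le = decode'-node (s≤s z≤n) k 0
  decode'-index (suc k) S        le = decode'-node (s≤s (s≤s z≤n)) k 0
  decode'-index (suc k) (P i)    le = decode'-node (s≤s (s≤s (s≤s z≤n))) k i
  decode'-index (suc k) (C f gs) le
    rewrite decode'-node (s≤s (s≤s (s≤s (s≤s z≤n)))) k (pair (index f) (indices gs))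
          | unpair-pair (index f) (indices gs) =
    cong₂ C (decode'-index k f (≤-trans (fst≤pair _ _) (arg≤fuel le)))
            (decodeL-indices k gs (≤-trans (snd≤pair _ _) (arg≤fuel le)))
  decode'-index (suc k) (R f g)  le
    rewrite decode'-node (s≤s (s≤s (s≤s (s≤s (s≤s z≤n))))) k (pair (index f) (index g))
          | unpair-pair (index f) (index g) =
    cong₂ R (decode'-index k f (≤-trans (fst≤pair _ _) (arg≤fuel le)))
            (decode'-index k g (≤-trans (snd≤pair _ _) (arg≤fuel le)))
  decode'-index (suc k) (M f)    le
    rewrite decode'-node (s≤s (s≤s (s≤s (s≤s (s≤s (s≤s z≤n)))))) k (index f) =
    cong M (decode'-index k f (arg≤fuel le))

  decodeL-indices : ∀ k gs → indices gs ≤ k → decodeL k (indices gs) ≡ gs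
  decodeL-indices zero    []       le = refl
  decodeL-indices (suc k) []       le = refl
  decodeL-indices (suc k) (g ∷ gs) (s≤s le)
    rewrite unpair-pair (index g) (indices gs) =
    cong₂ _∷_ (decode'-index k g (≤-trans (fst≤pair _ _) le))
              (decodeL-indices k gs (≤-trans (snd≤pair _ _) le))

decode-index : ∀ c → decode (index c) ≡ c
decode-index c = decode'-index (index c) c ≤-refl

·↓-intro : ∀ c {x y} → c ⟨ x ∷ [] ⟩⇓ y → index c · x ↓ y
·↓-intro c {x} {y} = subst (_⟨ x ∷ [] ⟩⇓ y) (sym (decode-index c))

·↓-elim : ∀ c {x y} → index c · x ↓ y → c ⟨ x ∷ [] ⟩⇓ y
·↓-elim c {x} {y} = subst (_⟨ x ∷ [] ⟩⇓ y) (decode-index c)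

·↓-functional : ∀ {e x y z} → e · x ↓ y → e · x ↓ z → y ≡ z
·↓-functional {e} = ⇓-functional {decode e}

-- A stack machine for codes

cons : ℕ → ℕ → ℕ
cons a l = suc (pair a l)

-- On 0, the empty list, both give 0 because `unpair 0` is (0 , 0); this agrees with the defaults of
-- `head0` and `tail0`.
hd tl : ℕ → ℕ
hd l = fst (pred l)
tl l = snd (pred l)

hd-cons : ∀ a l → hd (cons a l) ≡ a
hd-cons = fst-pair

tl-cons : ∀ a l → tl (cons a l) ≡ l
tl-cons = snd-pair

consᶠ : Fn → Fn → Fn
consᶠ f g = sucᶠ (pairᶠ f g)

hdᶠ tlᶠ : Fn → Fn
hdᶠ f = fstᶠ (predᶠ f)
tlᶠ f = sndᶠ (predᶠ f)

list : List ℕ → ℕ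
list []       = 0
list (x ∷ xs) = cons x (list xs)

hd-list : ∀ xs → hd (list xs) ≡ head0 xs
hd-list []       = refl
hd-list (x ∷ xs) = hd-cons x (list xs)

tl-list : ∀ xs → tl (list xs) ≡ list (tail0 xs)
tl-list []       = refl
tl-list (x ∷ xs) = tl-cons x (list xs)

-- A machine state is pair K v, where K is a list of instructions still to be
-- executed and v is the current value. An instruction is a tag together with
-- its operand; the tags 6, 7, 9 and 11 are continuation frames, which carry
-- run-time values.
zeroI sucI hdI tlI : ℕ
zeroI = pair 0 0
sucI  = pair 1 0
hdI   = pair 2 0
tlI   = pair 3 0

seqI tupleI tupleF recI : ℕ → ℕ → ℕ
seqI   a b = pair 4 (pair a b)
tupleI a b = pair 5 (pair a b)
tupleF b x = pair 6 (pair b x)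
recI   f g = pair 8 (pair f g)

consF minI : ℕ → ℕ
consF y = pair 7 y
minI  f = pair 10 f

-- `f` is the compiled body, `y` the candidate under test and `x` the original argument list.
minF : ℕ → ℕ → ℕ → ℕ
minF f y x = pair 11 (pair f (pair y x))

-- `i` counts the rounds already started, `m` those still to come, and `x` is the list of
-- parameters.
recF : ℕ → ℕ → ℕ → ℕ → ℕ
recF g i m x = pair 9 (pair g (pair i (pair m x)))

switch : Fn → List Fn → Fn
switch t []       = zeroᶠ
switch t (f ∷ fs) = ifzᶠ t f (switch (predᶠ t) fs)

-- The arguments are the tag, the operand, the remaining instructions and the current value; the
-- branches stand in the order of the tags 0 to 11.
execute : Fn
execute = switch (var 0) (
    pairᶠ K zeroᶠ
  ∷ pairᶠ K (sucᶠ (hdᶠ v))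
  ∷ pairᶠ K (hdᶠ v)
  ∷ pairᶠ K (tlᶠ v)
  ∷ pairᶠ (consᶠ D₁ (consᶠ D₂ K)) v
  ∷ pairᶠ (consᶠ D₁ (consᶠ (pairᶠ (lit 6) (pairᶠ D₂ v)) K)) v
  ∷ pairᶠ (consᶠ D₁ (consᶠ (pairᶠ (lit 7) v) K)) D₂
  ∷ pairᶠ K (consᶠ D v)
  ∷ pairᶠ (consᶠ D₁ (consᶠ (frameᶠ D₂ zeroᶠ (hdᶠ v) (tlᶠ v)) K)) (tlᶠ v)
  -- For a frame `recF g i m x` the projections are g = `D₁`, i = `D₂₁`, m = `D₂₂₁` and x = `D₂₂₂`.
  -- With m = 0 the current value is the result.
  ∷ ifzᶠ D₂₂₁
      (pairᶠ K v)
      (pairᶠ (consᶠ D₁ (consᶠ (frameᶠ D₁ (sucᶠ D₂₁) (predᶠ D₂₂₁) D₂₂₂) K))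
             (consᶠ D₂₁ (consᶠ v D₂₂₂)))
  ∷ pairᶠ (consᶠ D (consᶠ (pairᶠ (lit 11) (pairᶠ D (pairᶠ zeroᶠ v))) K)) (consᶠ zeroᶠ v)
  ∷ ifzᶠ v
      (pairᶠ K D₂₁)
      (pairᶠ (consᶠ D₁ (consᶠ (pairᶠ (lit 11) (pairᶠ D₁ (pairᶠ (sucᶠ D₂₁) D₂₂))) K))
             (consᶠ (sucᶠ D₂₁) D₂₂))
  ∷ [])
  where
  D K v D₁ D₂ D₂₁ D₂₂ D₂₂₁ D₂₂₂ : Fn
  D = var 1
  K = var 2
  v = var 3
  D₁ = fstᶠ D
  D₂ = sndᶠ D
  D₂₁ = fstᶠ D₂
  D₂₂ = sndᶠ D₂
  D₂₂₁ = fstᶠ D₂₂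
  D₂₂₂ = sndᶠ D₂₂

  frameᶠ : Fn → Fn → Fn → Fn → Fn
  frameᶠ g i m x = pairᶠ (lit 9) (pairᶠ g (pairᶠ i (pairᶠ m x)))

-- Opaque, since unfolding a step on an unknown state generates every branch.
opaque
  stepᶠ : Fn
  stepᶠ = ifzᶠ (fstᶠ (var 0)) (var 0)
    (compose execute (fstᶠ I ∷ sndᶠ I ∷ tlᶠ (fstᶠ (var 0)) ∷ sndᶠ (var 0) ∷ []))
    where
    I : Fn
    I = hdᶠ (fstᶠ (var 0))

step : ℕ → ℕ
step s = fun stepᶠ (s ∷ [])

opaque
  unfolding stepᶠ

  step-execute : ∀ t D K v →
    step (pair (cons (pair t D) K) v) ≡ fun execute (t ∷ D ∷ K ∷ v ∷ [])
  step-execute t D K v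
    rewrite fst-pair (cons (pair t D) K) v | snd-pair (cons (pair t D) K) v
          | fst-pair (pair t D) K | snd-pair (pair t D) K
          | fst-pair t D | snd-pair t D = refl

  step-halted : ∀ s → fst s ≡ 0 → step s ≡ s
  step-halted s eq rewrite eq = refl

runᶠ : Fn
runᶠ = recᶠ (var 0) (compose stepᶠ (var 1 ∷ []))

run : ℕ → ℕ → ℕ
run t s = fun runᶠ (t ∷ s ∷ [])

infix 4 _⟶*_

_⟶*_ : ℕ → ℕ → Set
s ⟶* s′ = ∃[ t ] run t s ≡ s′

⟶*-refl : ∀ {s} → s ⟶* s
⟶*-refl = 0 , refl

run-+ : ∀ t u s → run (t + u) s ≡ run t (run u s)
run-+ zero    u s = refl
run-+ (suc t) u s = cong step (run-+ t u s)

⟶*-trans : ∀ {s s′ s″} → s ⟶* s′ → s′ ⟶* s″ → s ⟶* s″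
⟶*-trans {s} (t , p) (u , q) = u + t , trans (run-+ u t s) (trans (cong (run u) p) q)

step-⟶* : ∀ {s s′ s″} → step s ≡ s′ → s′ ⟶* s″ → s ⟶* s″
step-⟶* eq = ⟶*-trans (1 , eq)

step-zeroI : ∀ K v → step (pair (cons zeroI K) v) ≡ pair K 0
step-zeroI K v = step-execute 0 0 K v

step-sucI : ∀ K v → step (pair (cons sucI K) v) ≡ pair K (suc (hd v))
step-sucI K v = step-execute 1 0 K v

step-hdI : ∀ K v → step (pair (cons hdI K) v) ≡ pair K (hd v)
step-hdI K v = step-execute 2 0 K v

step-tlI : ∀ K v → step (pair (cons tlI K) v) ≡ pair K (tl v)
step-tlI K v = step-execute 3 0 K v

step-seqI : ∀ a b K v → step (pair (cons (seqI a b) K) v) ≡ pair (cons a (cons b K)) v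
step-seqI a b K v
  rewrite step-execute 4 (pair a b) K v | fst-pair a b | snd-pair a b = refl

step-tupleI : ∀ a b K v →
  step (pair (cons (tupleI a b) K) v) ≡ pair (cons a (cons (tupleF b v) K)) v
step-tupleI a b K v
  rewrite step-execute 5 (pair a b) K v | fst-pair a b | snd-pair a b = refl

step-tupleF : ∀ b x K v →
  step (pair (cons (tupleF b x) K) v) ≡ pair (cons b (cons (consF v) K)) x
step-tupleF b x K v
  rewrite step-execute 6 (pair b x) K v | fst-pair b x | snd-pair b x = refl

step-consF : ∀ y K v → step (pair (cons (consF y) K) v) ≡ pair K (cons y v)
step-consF y K v = step-execute 7 y K v

step-recI : ∀ f g K v →
  step (pair (cons (recI f g) K) v) ≡ pair (cons f (cons (recF g 0 (hd v) (tl v)) K)) (tl v)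
step-recI f g K v
  rewrite step-execute 8 (pair f g) K v | fst-pair f g | snd-pair f g = refl

step-recF : ∀ g i m x K v → step (pair (cons (recF g i m x) K) v) ≡
  ifz m (pair K v) (pair (cons g (cons (recF g (suc i) (pred m) x) K)) (cons i (cons v x)))
step-recF g i m x K v
  rewrite step-execute 9 (pair g (pair i (pair m x))) K v
        | fst-pair g (pair i (pair m x)) | snd-pair g (pair i (pair m x))
        | fst-pair i (pair m x) | snd-pair i (pair m x)
        | fst-pair m x | snd-pair m x = refl

step-minI : ∀ f K v →
  step (pair (cons (minI f) K) v) ≡ pair (cons f (cons (minF f 0 v) K)) (cons 0 v)
step-minI f K v = step-execute 10 f K v

step-minF : ∀ f y x K v → step (pair (cons (minF f y x) K) v) ≡
  ifz v (pair K y) (pair (cons f (cons (minF f (suc y) x) K)) (cons (suc y) x))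
step-minF f y x K v
  rewrite step-execute 11 (pair f (pair y x)) K v
        | fst-pair f (pair y x) | snd-pair f (pair y x)
        | fst-pair y x | snd-pair y x = refl

-- Compilation of codes and its correctness

projection : ℕ → ℕ
projection zero    = hdI
projection (suc i) = seqI tlI (projection i)

mutual
  compile : Code → ℕ
  compile Z        = zeroI
  compile S        = sucI
  compile (P i)    = projection i
  compile (C f gs) = seqI (compileL gs) (compile f)
  compile (R f g)  = recI (compile f) (compile g)
  compile (M f)    = minI (compile f)

  compileL : List Code → ℕ
  -- The value 0 left by `zeroI` is the coded empty list.
  compileL []       = zeroI
  compileL (g ∷ gs) = tupleI (compile g) (compileL gs)

projection-⟶* : ∀ i xs K → pair (cons (projection i) K) (list xs) ⟶* pair K (nth0 i xs)
projection-⟶* zero [] K = 1 , step-hdI K 0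
projection-⟶* zero (x ∷ xs) K =
  step-⟶* (step-hdI K (list (x ∷ xs))) (0 , cong (pair K) (hd-cons x (list xs)))
projection-⟶* (suc i) [] K =
  step-⟶* (step-seqI _ _ K 0)
    (step-⟶* (step-tlI _ 0)
      (subst (λ y → pair (cons (projection i) K) 0 ⟶* pair K y) (nth0-[] i) (projection-⟶* i [] K)))
  where
  nth0-[] : ∀ i → nth0 i [] ≡ 0
  nth0-[] zero    = refl
  nth0-[] (suc i) = refl
projection-⟶* (suc i) (x ∷ xs) K =
  step-⟶* (step-seqI _ _ K _)
    (step-⟶* (trans (step-tlI _ _) (cong (pair _) (tl-cons x (list xs)))) (projection-⟶* i xs K))

mutual
  -- Induction on the fuel for an arbitrary remainder `K`: a compiled code replaces the argument
  -- list by its value and leaves `K` untouched, so the runs of subcodes can be chained.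
  eval-⟶* : ∀ k c xs {y} K → eval k c xs ≡ just y →
            pair (cons (compile c) K) (list xs) ⟶* pair K y
  eval-⟶* (suc k) Z xs K refl = 1 , step-zeroI K (list xs)
  eval-⟶* (suc k) S xs K refl =
    1 , trans (step-sucI K (list xs)) (cong (λ n → pair K (suc n)) (hd-list xs))
  eval-⟶* (suc k) (P i) xs K refl = projection-⟶* i xs K
  eval-⟶* (suc k) (C f gs) xs K eq
    with ys , eq₁ , eq₂ ← >>=-inversion (evalL k gs xs) _ eq =
    step-⟶* (step-seqI _ _ K (list xs))
      (⟶*-trans (evalL-⟶* k gs xs _ eq₁) (eval-⟶* k f ys K eq₂))
  eval-⟶* (suc k) (R f g) xs {y} K eq =
    step-⟶* (trans (step-recI _ _ K (list xs)) start)
      (⟶*-trans (evalR-⟶* k f g (head0 xs) 0 (tail0 xs) K eq)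
        (1 , step-recF (compile g) (head0 xs) 0 (list (tail0 xs)) K y))
    where
    start : pair (cons (compile f) (cons (recF (compile g) 0 (hd (list xs)) (tl (list xs))) K)) (tl (list xs))
          ≡ pair (cons (compile f) (cons (recF (compile g) 0 (head0 xs + 0) (list (tail0 xs))) K)) (list (tail0 xs))
    start rewrite hd-list xs | tl-list xs | +-identityʳ (head0 xs) = refl
  eval-⟶* (suc k) (M f) xs K eq =
    step-⟶* (step-minI _ K (list xs)) (evalM-⟶* k f xs 0 K eq)

  evalL-⟶* : ∀ k gs xs {ys} K → evalL k gs xs ≡ just ys →
             pair (cons (compileL gs) K) (list xs) ⟶* pair K (list ys)
  evalL-⟶* (suc k) [] xs K refl = 1 , step-zeroI K (list xs)
  evalL-⟶* (suc k) (g ∷ gs) xs K eq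
    with y , eq₁ , eq₂ ← >>=-inversion (eval k g xs) _ eq
    with ys , eq₃ , refl ← >>=-inversion (evalL k gs xs) _ eq₂ =
    step-⟶* (step-tupleI _ _ K (list xs))
      (⟶*-trans (eval-⟶* k g xs _ eq₁)
        (step-⟶* (step-tupleF _ _ K y)
          (⟶*-trans (evalL-⟶* k gs xs _ eq₃) (1 , step-consF y K (list ys)))))

  -- `evalR` descends from n while the machine counts upwards from 0. Holding m further rounds in
  -- reserve fixes the total n + m, so the induction on n can pass one round to the reserve.
  evalR-⟶* : ∀ k f g n m xs {y} K → evalR k f g n xs ≡ just y →
    pair (cons (compile f) (cons (recF (compile g) 0 (n + m) (list xs)) K)) (list xs)
    ⟶* pair (cons (recF (compile g) n m (list xs)) K) y
  evalR-⟶* (suc k) f g zero    m xs K eq = eval-⟶* k f xs _ eq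
  evalR-⟶* (suc k) f g (suc n) m xs K eq
    with r , eq₁ , eq₂ ← >>=-inversion (evalR k f g n xs) _ eq
    rewrite sym (+-suc n m) =
    ⟶*-trans (evalR-⟶* k f g n (suc m) xs K eq₁)
      (step-⟶* (step-recF _ n (suc m) _ K r) (eval-⟶* k g (n ∷ r ∷ xs) _ eq₂))

  evalM-⟶* : ∀ k f xs y {z} K → evalM k f xs y ≡ just z →
    pair (cons (compile f) (cons (minF (compile f) y (list xs)) K)) (cons y (list xs))
    ⟶* pair K z
  evalM-⟶* (suc k) f xs y K eq with >>=-inversion (eval k f (y ∷ xs)) _ eq
  ... | zero , eq₁ , refl =
    ⟶*-trans (eval-⟶* k f (y ∷ xs) _ eq₁) (1 , step-minF _ y _ K 0)
  ... | suc v , eq₁ , eq₂ =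
    ⟶*-trans (eval-⟶* k f (y ∷ xs) _ eq₁)
      (step-⟶* (step-minF _ y _ K (suc v)) (evalM-⟶* k f xs (suc y) K eq₂))

-- Halting, unbounded search and the diagonal function

Halted : ℕ → Set
Halted s = fst s ≡ 0

run-halted : ∀ t s → Halted s → run t s ≡ s
run-halted zero    s h = refl
run-halted (suc t) s h = trans (cong step (run-halted t s h)) (step-halted s h)

-- A known zero at `t` makes the upward search stop; the induction runs over the distance from the
-- current candidate to `t`.
M-⇓ : ∀ F xs t → fun F (t ∷ xs) ≡ 0 →
      ∃[ u ] (u ≤ t × fun F (u ∷ xs) ≡ 0 × M (code F) ⟨ xs ⟩⇓ u)
M-⇓ F xs t eq = let u , le , eq′ , k , p = search t 0 (trans (cong (λ n → fun F (n ∷ xs)) (+-identityʳ t)) eq)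
                in u , subst (u ≤_) (+-identityʳ t) le , eq′ , suc k , p
  where
  search : ∀ n y → fun F (n + y ∷ xs) ≡ 0 →
           ∃[ u ] (u ≤ n + y × fun F (u ∷ xs) ≡ 0 × ∃[ k ] evalM k (code F) xs y ≡ just u)
  search n y eq with fun F (y ∷ xs) in eq₀ | computes F (y ∷ xs)
  ... | zero | k , p = y , m≤n+m y n , eq₀ , suc k , found
    where
    found : evalM (suc k) (code F) xs y ≡ just y
    found rewrite p = refl
  search zero    y eq | suc v | _ = case trans (sym eq₀) eq of λ ()
  search (suc n) y eq | suc v | k , p
    with u , le , eq′ , l , q ← search n (suc y) (subst (λ m → fun F (m ∷ xs) ≡ 0) (sym (+-suc n y)) eq) =
    u , subst (u ≤_) (+-suc n y) le , eq′ , suc (k ⊔ l) , continue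
    where
    continue : evalM (suc (k ⊔ l)) (code F) xs y ≡ just u
    continue rewrite eval-mono (code F) (y ∷ xs) (m≤m⊔n k l) p =
      evalM-mono (code F) xs (suc y) (m≤n⊔m k l) q

initial : ℕ → ℕ
initial x = pair x (cons (suc (pair 0 x)) 0)

initialᶠ : Fn
initialᶠ = pairᶠ (var 0) (consᶠ (sucᶠ (pairᶠ zeroᶠ (var 0))) zeroᶠ)

iterateUntil : Fn → Fn → Fn → Code
iterateUntil stop out init = C (code out) (C (M (code stop)) (code init ∷ []) ∷ code init ∷ [])

iterateUntil-⇓ : ∀ stop out init xs t → fun stop (t ∷ fun init xs ∷ []) ≡ 0 →
  ∃[ u ] (u ≤ t × fun stop (u ∷ fun init xs ∷ []) ≡ 0 ×
          iterateUntil stop out init ⟨ xs ⟩⇓ fun out (u ∷ fun init xs ∷ []))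
iterateUntil-⇓ stop out init xs t eq
  with u , le , stopped , u⇓ ← M-⇓ stop (fun init xs ∷ []) t eq =
  u , le , stopped ,
  ⇓-C (⇓*-∷ (⇓-C (⇓*-∷ (computes init xs) ⇓*-[]) u⇓) (⇓*-∷ (computes init xs) ⇓*-[]))
      (computes out _)

-- Runs the machine program x on the one-element argument list suc (pair 0 x),
-- the coded form of the datum pair 0 x.
opaque
  ψ : Code
  ψ = iterateUntil (fstᶠ runᶠ) (sndᶠ runᶠ) initialᶠ

  ψ-⇓ : ∀ {x s} → initial x ⟶* s → Halted s → ψ ⟨ x ∷ [] ⟩⇓ snd s
  ψ-⇓ {x} {s} (t , eq) h =
    let u , u≤t , halted , result =
          iterateUntil-⇓ (fstᶠ runᶠ) (sndᶠ runᶠ) initialᶠ (x ∷ []) t (trans (cong fst eq) h)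
    in subst (λ s′ → ψ ⟨ x ∷ [] ⟩⇓ snd s′) (run-until u≤t halted) result
    where
    open ≡-Reasoning
    -- The search may stop at a time `u` before `t`, but a halted state no longer changes, so the
    -- result is the same.
    run-until : ∀ {u} → u ≤ t → Halted (run u (initial x)) → run u (initial x) ≡ s
    run-until {u} u≤t halted = begin
      run u (initial x)                ≡⟨ run-halted (t ∸ u) _ halted ⟨
      run (t ∸ u) (run u (initial x))  ≡⟨ run-+ (t ∸ u) u (initial x) ⟨
      run (t ∸ u + u) (initial x)      ≡⟨ cong (λ n → run n (initial x)) (m∸n+n≡m u≤t) ⟩
      run t (initial x)                ≡⟨ eq ⟩
      s                                ∎

program : Code → ℕ
program c = cons (compile c) 0

-- The diagonal step: the datum on which `c` is run contains the program of `c` itself.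
ψ-program : ∀ c {y} → c ⟨ suc (pair 0 (program c)) ∷ [] ⟩⇓ y → ψ ⟨ program c ∷ [] ⟩⇓ y
ψ-program c {y} (k , eq) =
  subst (ψ ⟨ program c ∷ [] ⟩⇓_) (snd-pair 0 y) (ψ-⇓ (eval-⟶* k c _ 0 eq) (fst-pair 0 y))

-- Program 0 is the empty instruction list, halted from the start. The learner consults this value
-- on the pause symbol, whose code 0 yields 0 under `snd` and `pred`.
ψ-zero-defined : ∃[ r ] ψ ⟨ 0 ∷ [] ⟩⇓ r
ψ-zero-defined = _ , ψ-⇓ ⟶*-refl (fst-pair 0 _)

-- Hypotheses for pairs

⁅_,_⁆ : ℕ → ℕ → SetN
⁅ a , b ⁆ y = y ≡ a ⊎ y ≡ b

distance : ℕ → ℕ → ℕ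
distance a b = (a ∸ b) + (b ∸ a)

distance≡0⇒≡ : ∀ {a b} → distance a b ≡ 0 → a ≡ b
distance≡0⇒≡ {a} {b} eq =
  ≤-antisym (m∸n≡0⇒m≤n (m+n≡0⇒m≡0 (a ∸ b) eq)) (m∸n≡0⇒m≤n (m+n≡0⇒n≡0 (a ∸ b) eq))

distance-refl : ∀ a → distance a a ≡ 0
distance-refl a = cong₂ _+_ (n∸n≡0 a) (n∸n≡0 a)

member : ℕ → ℕ → ℕ → ℕ
member y a b = ifz (distance y a) 1 (ifz (distance y b) 1 0)

opaque
  memberᶠ : Fn
  memberᶠ = ifzᶠ (distanceᶠ (var 0) (var 1)) (lit 1) (ifzᶠ (distanceᶠ (var 0) (var 2)) (lit 1) (lit 0))
    where
    distanceᶠ : Fn → Fn → Fn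
    distanceᶠ f g = (f ∸ᶠ g) +ᶠ (g ∸ᶠ f)

  memberᶠ-fun : ∀ y a b → fun memberᶠ (y ∷ a ∷ b ∷ []) ≡ member y a b
  memberᶠ-fun y a b = refl

member≤1 : ∀ y a b → member y a b ≤ 1
member≤1 y a b with distance y a | distance y b
... | zero  | _     = ≤-refl
... | suc _ | zero  = ≤-refl
... | suc _ | suc _ = z≤n

member-sound : ∀ y a b → member y a b ≡ 1 → ⁅ a , b ⁆ y
member-sound y a b eq with distance y a in p | distance y b in q
... | zero  | _    = inj₁ (distance≡0⇒≡ p)
... | suc _ | zero = inj₂ (distance≡0⇒≡ q)

member-complete : ∀ y a b → ⁅ a , b ⁆ y → member y a b ≡ 1
member-complete y a b (inj₁ refl) rewrite distance-refl y = refl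
member-complete y a b (inj₂ refl) rewrite distance-refl y with distance y a
... | zero  = refl
... | suc _ = refl

-- An instance of the s-m-n construction: `a` and `b` are built into the code as constants.
characteristic : ℕ → ℕ → Code
characteristic a b = C (code memberᶠ) (P 0 ∷ constant a ∷ constant b ∷ [])

characteristic-⇓ : ∀ a b y → characteristic a b ⟨ y ∷ [] ⟩⇓ member y a b
characteristic-⇓ a b y =
  ⇓-C (⇓*-∷ (1 , refl) (⇓*-∷ (constant-⇓ a _) (⇓*-∷ (constant-⇓ b _) ⇓*-[])))
      (subst (code memberᶠ ⟨ y ∷ a ∷ b ∷ [] ⟩⇓_) (memberᶠ-fun y a b) (computes memberᶠ _))

pairIndex : ℕ → ℕ → ℕ
pairIndex a b = index (characteristic a b)

pairIndex-CIndex : ∀ a b → CIndex (pairIndex a b)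
pairIndex-CIndex a b =
  (λ y → member y a b , ·↓-intro (characteristic a b) (characteristic-⇓ a b y)) ,
  (λ y z ↓z → subst (_≤ 1) (⇓-functional (characteristic-⇓ a b y) (·↓-elim (characteristic a b) ↓z))
                           (member≤1 y a b))

pairIndex-≐ : ∀ a b → (λ y → y ∈C pairIndex a b) ≐ ⁅ a , b ⁆
pairIndex-≐ a b y = mk⇔
  (λ ↓1 → member-sound y a b
            (⇓-functional (characteristic-⇓ a b y) (·↓-elim (characteristic a b) ↓1)))
  (λ y∈ → ·↓-intro (characteristic a b)
            (subst (characteristic a b ⟨ y ∷ [] ⟩⇓_) (member-complete y a b y∈) (characteristic-⇓ a b y)))

compositionNodeᶠ : Fn → Fn
compositionNodeᶠ = lift₁ F (node 3) spec
  where
  F : Fn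
  F = recᶠ (lit 3) (lit 6 +ᶠ var 1)

  spec : ∀ r → fun F (r ∷ []) ≡ node 3 r
  spec zero    = sym (node-zero 3)
  spec (suc r) = trans (cong (6 +_) (spec r)) (sym (node-suc 3 r))

-- The code of n + 1 wraps the code of n in one composition with `S`, so its index is obtained by
-- recursion on n.
constantIndexᶠ : Fn → Fn
constantIndexᶠ = lift₁ F (λ n → index (constant n)) spec
  where
  F : Fn
  F = recᶠ (lit (index Z)) (compositionNodeᶠ (pairᶠ (lit (index S)) (consᶠ (var 1) zeroᶠ)))

  spec : ∀ n → fun F (n ∷ []) ≡ index (constant n)
  spec zero    = refl
  spec (suc n) = cong (λ i → node 3 (pair (index S) (cons i 0))) (spec n)

-- This mirrors `index` on `characteristic` clause by clause, so its function unfolds to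
-- `pairIndex`; through it the learner computes its hypotheses.
pairIndexᶠ : Fn → Fn → Fn
pairIndexᶠ f g = compositionNodeᶠ (pairᶠ (lit (index (code memberᶠ)))
  (consᶠ (lit (index (P 0))) (consᶠ (constantIndexᶠ f) (consᶠ (constantIndexᶠ g) zeroᶠ))))

-- The partial learner

guess : ℕ → ℕ
guess d = suc (pairIndex (pair 0 (snd d)) d)

-- `n` is a coded input and `r` the value of `ψ` at the second component of its datum. As an output,
-- 0 means "?" and a successor is a hypothesis.
respond : ℕ → ℕ → ℕ
respond n r = ifz n 0 (ifz (fst (pred n)) (ifz r (guess (pred n)) 0) (guess (pred n)))

respondᶠ : Fn
respondᶠ = ifzᶠ (var 0) zeroᶠ (ifzᶠ (fstᶠ (predᶠ (var 0))) (ifzᶠ (var 1) guessᶠ zeroᶠ) guessᶠ)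
  where
  guessᶠ : Fn
  guessᶠ = sucᶠ (pairIndexᶠ (pairᶠ zeroᶠ (sndᶠ (predᶠ (var 0)))) (predᶠ (var 0)))

opaque
  -- Composition evaluates all its arguments, so the learner is defined only where `ψ` is, even when
  -- `respond` ignores `r`.
  learner : Code
  learner = C (code respondᶠ) (P 0 ∷ C ψ (code (sndᶠ (predᶠ (var 0))) ∷ []) ∷ [])

  learner-⇓ : ∀ {n r} → ψ ⟨ snd (pred n) ∷ [] ⟩⇓ r → learner ⟨ n ∷ [] ⟩⇓ respond n r
  learner-⇓ {n} {r} ψ⇓ =
    ⇓-C (⇓*-∷ (1 , refl) (⇓*-∷ (⇓-C (⇓*-∷ (computes (sndᶠ (predᶠ (var 0))) _) ⇓*-[]) ψ⇓) ⇓*-[]))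
        (computes respondᶠ (n ∷ r ∷ []))

learner-pause : learner ⟨ 0 ∷ [] ⟩⇓ 0
learner-pause = learner-⇓ (proj₂ ψ-zero-defined)

learner-datum : ∀ {x r} s → ψ ⟨ x ∷ [] ⟩⇓ r →
  let q = pairIndex (pair 0 x) (pair s x) in
  learner ⟨ suc (pair s x) ∷ [] ⟩⇓ ifz s (ifz r (suc q) 0) (suc q)
learner-datum {x} {r} s ψ⇓ =
  subst (learner ⟨ suc (pair s x) ∷ [] ⟩⇓_) respond-datum
    (learner-⇓ (subst (λ z → ψ ⟨ z ∷ [] ⟩⇓ r) (sym (snd-pair s x)) ψ⇓))
  where
  q : ℕ
  q = pairIndex (pair 0 x) (pair s x)

  respond-datum : respond (suc (pair s x)) r ≡ ifz s (ifz r (suc q) 0) (suc q)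
  respond-datum = cong₂ (λ s′ q′ → ifz s′ (ifz r (suc q′) 0) (suc q′))
    (fst-pair s x) (cong (λ z → pairIndex (pair 0 z) (pair s x)) (snd-pair s x))

-- The only possible change in the sequence is from "?" to `e`; after the first answer `e` it is
-- constant.
learns-single-hypothesis : ∀ h e T →
  (∀ i → (h · codeIn (T i) ↓ 0) ⊎ (h · codeIn (T i) ↓ suc e)) →
  ∃[ i ] (h · codeIn (T i) ↓ suc e) →
  CIndex e → (λ x → x ∈C e) ≐ content T →
  ∃[ p ] (IsTd h T p × CInd p × ExC p T)
learns-single-hypothesis h e T answer (i , i↓) e-index e≐T =
  p , (refl , follows) , cind , suc i , stable , e , at-suc-i , e-index , e≐T
  where
  update : ∀ {A B : Set} → A ⊎ B → Maybe ℕ → Maybe ℕ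
  update (inj₁ _) m = m
  update (inj₂ _) _ = just e

  p : HypSeq
  p zero    = nothing
  p (suc j) = update (answer j) (p j)

  follows : ∀ j → ((h · codeIn (T j) ↓ 0) × (p (suc j) ≡ p j))
                ⊎ (∃[ q ] ((h · codeIn (T j) ↓ suc q) × (p (suc j) ≡ just q)))
  follows j with answer j
  ... | inj₁ ↓0 = inj₁ (↓0 , refl)
  ... | inj₂ ↓e = inj₂ (e , ↓e , refl)

  cind : CInd p
  cind zero = inj₁ refl
  cind (suc j) with answer j
  ... | inj₁ _ = cind j
  ... | inj₂ _ = inj₂ (e , refl , e-index)

  at-suc-i : p (suc i) ≡ just e
  at-suc-i with answer i
  ... | inj₁ ↓0 = case ·↓-functional {h} ↓0 i↓ of λ ()
  ... | inj₂ _  = refl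

  persists : ∀ j → p j ≡ just e → p (suc j) ≡ just e
  persists j eq with answer j
  ... | inj₁ _ = eq
  ... | inj₂ _ = refl

  later : ∀ d → p (d + suc i) ≡ just e
  later zero    = at-suc-i
  later (suc d) = persists (d + suc i) (later d)

  stable : ∀ n → suc i ≤ n → p n ≡ p (suc i)
  stable n le = trans (trans (cong p (sym (m∸n+n≡m le))) (later (n ∸ suc i))) (sym at-suc-i)

-- The separating class and its partial learner

≐-refl : ∀ {A : SetN} → A ≐ A
≐-refl x = ⇔-id _

≐-sym : ∀ {A B : SetN} → A ≐ B → B ≐ A
≐-sym A≐B x = ⇔-sym (A≐B x)

≐-trans : ∀ {A B D : SetN} → A ≐ B → B ≐ D → A ≐ D
≐-trans A≐B B≐D x = B≐D x ⇔-∘ A≐B x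

data SameSign : ℕ → ℕ → Set where
  zeros     : SameSign 0 0
  positives : ∀ {m n} → SameSign (suc m) (suc n)

-- For t = 0 the two elements coincide, so the set is the singleton of `pair 0 x`.
Family : SetN → Set
Family L = ∃[ x ] ∃[ r ] ∃[ t ]
  (ψ ⟨ x ∷ [] ⟩⇓ r × SameSign r t × L ≐ ⁅ pair 0 x , pair t x ⁆)

learner-final : ∀ {x r t} → ψ ⟨ x ∷ [] ⟩⇓ r → SameSign r t →
                index learner · suc (pair t x) ↓ suc (pairIndex (pair 0 x) (pair t x))
learner-final ψ⇓ zeros             = ·↓-intro learner (learner-datum 0 ψ⇓)
learner-final ψ⇓ (positives {n = n}) = ·↓-intro learner (learner-datum (suc n) ψ⇓)

-- If `ψ` vanishes at x, the shared element is the whole set and already draws the final answer;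
-- otherwise it leaves t open and draws "?".
learner-shared : ∀ {x r t} → ψ ⟨ x ∷ [] ⟩⇓ r → SameSign r t →
                 (index learner · suc (pair 0 x) ↓ 0)
               ⊎ (index learner · suc (pair 0 x) ↓ suc (pairIndex (pair 0 x) (pair t x)))
learner-shared ψ⇓ zeros     = inj₂ (learner-final ψ⇓ zeros)
learner-shared ψ⇓ positives = inj₁ (·↓-intro learner (learner-datum 0 ψ⇓))

learner-learns : ∀ L → Family L → IsREC L × Learns (index learner) L
learner-learns L (x , r , t , ψ⇓ , same , L≐) =
  (q , pairIndex-CIndex a b , ≐-trans {L} L≐ (≐-sym (pairIndex-≐ a b))) , learns
  where
  a b q : ℕ
  a = pair 0 x
  b = pair t x
  q = pairIndex a b

  on-b : index learner · suc b ↓ suc q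
  on-b = learner-final ψ⇓ same

  learns : Learns (index learner) L
  learns T T≐L = learns-single-hypothesis (index learner) q T answer found (pairIndex-CIndex a b)
                   (≐-trans (pairIndex-≐ a b) (≐-sym T≐pair))
    where
    T≐pair : content T ≐ ⁅ a , b ⁆
    T≐pair = ≐-trans {content T} T≐L L≐

    answer : ∀ i → (index learner · codeIn (T i) ↓ 0) ⊎ (index learner · codeIn (T i) ↓ suc q)
    answer i with T i in eq
    ... | nothing = inj₁ (·↓-intro learner learner-pause)
    ... | just y with Equivalence.to (T≐pair y) (i , eq)
    ...   | inj₁ refl = learner-shared ψ⇓ same
    ...   | inj₂ refl = inj₂ on-b

    found : ∃[ i ] (index learner · codeIn (T i) ↓ suc q)
    found with i , eq ← Equivalence.from (T≐pair b) (inj₂ refl) =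
      i , subst (λ m → index learner · codeIn m ↓ suc q) (sym eq) on-b

-- Failure of every total learner

constantly_after_ : ℕ → ℕ → Text
(constantly a after b) zero    = just b
(constantly a after b) (suc _) = just a

content-after : ∀ a b → content (constantly a after b) ≐ ⁅ a , b ⁆
content-after a b y = mk⇔
  (λ { (zero , refl) → inj₂ refl ; (suc _ , refl) → inj₁ refl })
  (λ { (inj₁ refl) → 1 , refl ; (inj₂ refl) → 0 , refl })

module _ {h : ℕ} {T : Text} {p : HypSeq} (td : IsTd h T p) where

  Td-? : ∀ i → h · codeIn (T i) ↓ 0 → p (suc i) ≡ p i
  Td-? i ↓0 with proj₂ td i
  ... | inj₁ (_ , eq)      = eq
  ... | inj₂ (_ , ↓q , _)  = case ·↓-functional {h} ↓0 ↓q of λ ()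

  Td-hypothesis : ∀ i {q} → h · codeIn (T i) ↓ suc q → p (suc i) ≡ just q
  Td-hypothesis i ↓q with proj₂ td i
  ... | inj₁ (↓0 , _)        = case ·↓-functional {h} ↓0 ↓q of λ ()
  ... | inj₂ (q′ , ↓q′ , eq) = trans eq (cong just (suc-injective (·↓-functional {h} ↓q′ ↓q)))

singleton-answered : ∀ {h a} → Learns h ⁅ a , a ⁆ → ¬ (h · suc a ↓ 0)
singleton-answered {h} {a} learns ↓0
  with p , td , _ , n₀ , _ , e , p≡e , _ ← learns (constantly a after a) (content-after a a) =
  case trans (sym (silent n₀)) p≡e of λ ()
  where
  silent : ∀ n → p n ≡ nothing
  silent zero          = proj₁ td
  silent (suc zero)    = trans (Td-? {h} td 0 ↓0) (silent 0)
  silent (suc (suc n)) = trans (Td-? {h} td (suc n) ↓0) (silent (suc n))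

repeated-answer-correct : ∀ {h a b q} → Learns h ⁅ a , b ⁆ → h · suc a ↓ suc q →
                          (λ y → y ∈C q) ≐ ⁅ a , b ⁆
repeated-answer-correct {h} {a} {b} {q} learns ↓q
  with p , td , _ , n₀ , stable , e , p≡e , _ , e≐T ←
    learns (constantly a after b) (content-after a b)
  -- From position 1 on the text is constantly `a`, so the hypothesis at 2 + n₀ is `q`; being past
  -- n₀, it is also the limit `e`.
  with refl ← just-injective (trans (sym p≡e)
         (trans (sym (stable (2 + n₀) (m≤n+m n₀ 2))) (Td-hypothesis {h} td (suc n₀) ↓q))) =
  ≐-trans e≐T (content-after a b)

no-total-learner : ¬ InR Family
no-total-learner (h , total , learns) = refute (total (suc (pair 0 x)))
  where
  x : ℕ
  x = program (decode h)

  refute : ¬ (∃[ y ] h · suc (pair 0 x) ↓ y)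
  refute (zero , ↓0) =
    singleton-answered {h}
      (proj₂ (learns _ (x , 0 , 0 , ψ-program (decode h) ↓0 , zeros , ≐-refl))) ↓0
  -- `q-correct` is shifted by one: its instances 0 and 1 concern t = 1 and t = 2. The element
  -- `pair 2 x` of the second set would lie in the first.
  refute (suc q , ↓q) = distinct (Equivalence.to (q-correct 0 (pair 2 x))
                                   (Equivalence.from (q-correct 1 (pair 2 x)) (inj₂ refl)))
    where
    q-correct : ∀ t → (λ y → y ∈C q) ≐ ⁅ pair 0 x , pair (suc t) x ⁆
    q-correct t = repeated-answer-correct {h}
      (proj₂ (learns _ (x , suc q , suc t , ψ-program (decode h) ↓q , positives , ≐-refl))) ↓q

    pair-injectiveˡ : ∀ {s t} → pair s x ≡ pair t x → s ≡ t
    pair-injectiveˡ {s} {t} eq = trans (sym (fst-pair s x)) (trans (cong fst eq) (fst-pair t x))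

    distinct : ¬ ⁅ pair 0 x , pair 1 x ⁆ (pair 2 x)
    distinct (inj₁ eq) = case pair-injectiveˡ eq of λ ()
    distinct (inj₂ eq) = case pair-injectiveˡ eq of λ ()

theorem7 : ((𝓛 : SetN → Set) → InR 𝓛 → InP 𝓛) × (∃[ 𝓛 ] (InP 𝓛 × ¬ InR 𝓛))
theorem7 = (λ { 𝓛 (h , _ , learns) → h , learns })
         , Family , (index learner , learner-learns) , no-total-learner
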